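{- Let $G$ be a finite simple graph of order $n\geq 2$, and let $\overline{G}$ denote its complement. If $G$ is not isomorphic to the $5$-cycle $C_5$, then $\gamma_{\rm ri2}(G)+\gamma_{\rm ri2}(\overline{G})\leq n+2$.
   Context: For a positive integer $k$, a $k$-rainbow independent dominating function ($k$RiDF) of a graph $G$ is a function $f: V(G)\to\{0,1,\ldots,k\}$ such that, writing $V_i=\{v: f(v)=i\}$, for every $i\in\{1,\ldots,k\}$ the set $V_i$ is an independent set of $G$ and every vertex $v$ with $f(v)=0$ is adjacent to some vertex $u$ with $f(u)=i$. The weight of $f$ is the number of vertices $v$ with $f(v)\neq 0$. The $k$-rainbow independent domination number $\gamma_{\rm rik}(G)$ is the minimum weight of a $k$RiDF of $G$; in particular $\gamma_{\rm ri2}(G)$ is this quantity for $k=2$. The order of $G$ is $|V(G)|$. -}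

module Defs where

open import Data.Nat using (ℕ; zero; suc; _+_; _≤_)
open import Data.Fin using (Fin; zero; suc; toℕ)
open import Data.Fin.Properties using (_≟_)
open import Data.Product using (Σ; ∃; _×_; _,_)
open import Data.List using (List; length; filter)
open import Data.List.Base using (allFin)
open import Relation.Nullary using (¬_; Dec)
open import Relation.Nullary using (¬?)
open import Relation.Binary.PropositionalEquality using (_≡_; _≢_)
open import Function.Definitions using (Bijective)
open import Data.Nat using (_%_)
open import Data.Sum using (_⊎_; inj₁; inj₂)
open import Relation.Binary.PropositionalEquality using (refl) renaming (sym to ≡-sym)

record SimpleGraph (n : ℕ) : Set₁ where
  field
    Adj   : Fin n → Fin n → Set
    sym   : ∀ {u v} → Adj u v → Adj v u
    irrefl : ∀ {v} → ¬ Adj v v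

open SimpleGraph public

complement : ∀ {n} → SimpleGraph n → SimpleGraph n
complement G = record
  { Adj = λ u v → (u ≢ v) × ¬ Adj G u v
  ; sym = λ { (u≢v , ¬a) → (λ e → u≢v (≡-sym e)) , (λ a → ¬a (sym G a)) }
  ; irrefl = λ { (v≢v , _) → v≢v refl }
  }

record Is2RiDF {n : ℕ} (G : SimpleGraph n) (f : Fin n → Fin 3) : Set where
  field
    independent : ∀ (i : Fin 3) → i ≢ zero → ∀ u v → f u ≡ i → f v ≡ i → ¬ Adj G u v
    dominating  : ∀ v → f v ≡ zero → ∀ (i : Fin 3) → i ≢ zero →
                  Σ (Fin n) (λ u → Adj G v u × f u ≡ i)

weight : ∀ {n} → (Fin n → Fin 3) → ℕ
weight {n} f = length (filter (λ v → ¬? (f v ≟ zero)) (allFin n))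

IsRi2Number : ∀ {n} → SimpleGraph n → ℕ → Set
IsRi2Number {n} G m =
  (Σ (Fin n → Fin 3) λ f → Is2RiDF G f × weight f ≡ m)
  × (∀ (f : Fin n → Fin 3) → Is2RiDF G f → m ≤ weight f)

C5 : SimpleGraph 5
C5 = record
  { Adj = λ i j → (toℕ j ≡ (suc (toℕ i)) % 5) ⊎ (toℕ i ≡ (suc (toℕ j)) % 5)
  ; sym = λ { (inj₁ e) → inj₂ e ; (inj₂ e) → inj₁ e }
  ; irrefl = irr
  }
  where
  irr : ∀ {v : Fin 5} → ¬ ((toℕ v ≡ (suc (toℕ v)) % 5) ⊎ (toℕ v ≡ (suc (toℕ v)) % 5))
  irr {zero} (inj₁ ())
  irr {zero} (inj₂ ())
  irr {suc zero} (inj₁ ())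
  irr {suc zero} (inj₂ ())
  irr {suc (suc zero)} (inj₁ ())
  irr {suc (suc zero)} (inj₂ ())
  irr {suc (suc (suc zero))} (inj₁ ())
  irr {suc (suc (suc zero))} (inj₂ ())
  irr {suc (suc (suc (suc zero)))} (inj₁ ())
  irr {suc (suc (suc (suc zero)))} (inj₂ ())

record Isomorphic {n m : ℕ} (G : SimpleGraph n) (H : SimpleGraph m) : Set where
  field
    φ     : Fin n → Fin m
    bij   : Bijective {A = Fin n} _≡_ _≡_ φ
    preserves : ∀ u v → Adj G u v → Adj H (φ u) (φ v)
    reflects  : ∀ u v → Adj H (φ u) (φ v) → Adj G u v

{-# OPTIONS --safe #-}
module Submission where

-- Let f colour G with classes A, B and g colour the complement with classes C, D. The sum of
-- the weights is n + (number of vertices coloured by both) − (number coloured by neither), and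
-- A∩C, A∩D, B∩C, B∩D have at most one vertex each. So f and g are good enough as soon as the
-- number of vertices missed by both plus the number of empty intersections is at least 2.
-- Disjoint independent sets extend greedily to a 2RiDF, so f and g are produced from seeds.
--
-- If N(v₂) ⊆ N[v₁], seed A, C with v₁ and B, D with v₂: then A∩D is empty, and one can
-- either miss a vertex, or keep B∩C empty, or pass to a nested pair with fewer distinguishing
-- vertices. If no neighbourhoods are nested, look for two vertices that both f and g miss.
-- When there are none, a vertex with three neighbours leads to a contradiction, in G and dually
-- in the complement; so all degrees are 2 in both graphs, and G is the 5-cycle.
--
-- Adjacency may be assumed decidable because the conclusion is stable under double negation.

open import Defs
open import Data.Nat using (ℕ; zero; suc; _+_; _≤_; _<_; z≤n; s≤s)
open import Data.Nat.Induction using (<-wellFounded)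
open import Data.Nat.Properties using (+-0-commutativeMonoid; +-mono-≤; +-monoʳ-≤; +-cancelʳ-≤; +-comm; +-assoc; ≤-trans; ≤-reflexive; ≤-refl; m≤m+n; m≤n+m; _≤?_; module ≤-Reasoning)
open import Data.Fin using (Fin; zero; suc)
open import Data.Fin.Patterns using (0F; 1F; 2F; 3F; 4F)
open import Data.Fin.Properties using (_≟_; any?; ∀-cons; suc-injective)
open import Data.Product using (∃-syntax; _×_; _,_; proj₁; proj₂)
open import Data.Sum using (_⊎_; inj₁; inj₂; swap)
open import Data.Empty using (⊥; ⊥-elim)
open import Data.List using (_∷_; []; length; filter; allFin; tabulate)
open import Data.List.Membership.Propositional using (_∈_; lose)
open import Data.List.Membership.Propositional.Properties using (∈-allFin; ∈-filter⁺)
open import Data.List.Properties using (filter-notAll)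
open import Data.List.Relation.Unary.Any using (here; there)
open import Data.Vec.Functional using (updateAt)
open import Data.Vec.Functional.Properties using (updateAt-updates; updateAt-minimal)
open import Function using (_∘_; id; const)
open import Induction.WellFounded using (Acc; acc)
open import Relation.Nullary using (¬_; Dec; yes; no; ¬?; contradiction)
open import Relation.Nullary.Decidable using (_×-dec_; _⊎-dec_; decidable-stable; ¬¬-excluded-middle)
open import Relation.Unary using (Decidable)
open import Relation.Binary.PropositionalEquality using (_≡_; _≢_; refl; trans; cong; cong₂; subst; subst₂; module ≡-Reasoning) renaming (sym to ≡-sym)
open import Algebra.Properties.CommutativeMonoid.Sum +-0-commutativeMonoid using (sum; ∑-distrib-+; sum-cong-≗)

private
  variable
    n : ℕ

pattern c₁ = suc zero
pattern c₂ = suc (suc zero)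

-- Sums over Fin n

sum-ones : ∀ n → sum {n} (const 1) ≡ n
sum-ones zero    = refl
sum-ones (suc n) = cong suc (sum-ones n)

sum-zero : (t : Fin n → ℕ) → (∀ v → t v ≡ 0) → sum t ≡ 0
sum-zero {zero}  t t≡0 = refl
sum-zero {suc n} t t≡0 = cong₂ _+_ (t≡0 zero) (sum-zero (t ∘ suc) (t≡0 ∘ suc))

term≤sum : (t : Fin n → ℕ) → ∀ v → t v ≤ sum t
term≤sum t zero    = m≤m+n (t zero) _
term≤sum t (suc v) = ≤-trans (term≤sum (t ∘ suc) v) (m≤n+m _ (t zero))

two-terms≤sum : (t : Fin n → ℕ) → ∀ u v → u ≢ v → t u + t v ≤ sum t
two-terms≤sum t zero    zero    u≢v = contradiction refl u≢v
two-terms≤sum t zero    (suc v) _   = +-monoʳ-≤ (t zero) (term≤sum (t ∘ suc) v)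
two-terms≤sum t (suc u) zero    _   =
  ≤-trans (≤-reflexive (+-comm (t (suc u)) _)) (+-monoʳ-≤ (t zero) (term≤sum (t ∘ suc) u))
two-terms≤sum t (suc u) (suc v) u≢v =
  ≤-trans (two-terms≤sum (t ∘ suc) u v (u≢v ∘ cong suc)) (m≤n+m _ (t zero))

sum≤1 : (t : Fin n → ℕ) → (∀ v → t v ≤ 1) →
        (∀ u v → t u ≢ 0 → t v ≢ 0 → u ≡ v) → sum t ≤ 1
sum≤1 {zero}  t t≤1 unique = z≤n
sum≤1 {suc n} t t≤1 unique with t zero in eq
... | zero  = sum≤1 (t ∘ suc) (t≤1 ∘ suc)
                (λ u v tu tv → suc-injective (unique (suc u) (suc v) tu tv))
... | suc k = ≤-trans (≤-reflexive (trans (cong (suc k +_) rest) (trans (+-comm _ 0) (≡-sym eq)))) (t≤1 zero)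
  where
  rest : sum (t ∘ suc) ≡ 0
  rest = sum-zero (t ∘ suc) λ v → at v (t (suc v)) refl
    where
    at : ∀ v m → t (suc v) ≡ m → t (suc v) ≡ 0
    at v zero    e = e
    at v (suc m) e with unique zero (suc v) (λ z → contradiction (trans (≡-sym eq) z) λ ()) (λ z → contradiction (trans (≡-sym e) z) λ ())
    ... | ()

-- Weights and overlaps of a pair of colourings

nonzero : Fin 3 → ℕ
nonzero zero    = 0
nonzero (suc _) = 1

weight≡sum : (f : Fin n → Fin 3) → weight f ≡ sum (nonzero ∘ f)
weight≡sum f = go id
  where
  go : ∀ {m} (h : Fin m → Fin _) →
       length (filter (λ v → ¬? (f v ≟ zero)) (tabulate h)) ≡ sum (nonzero ∘ f ∘ h)
  go {zero}  h = refl
  go {suc m} h with f (h zero)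
  ... | zero  = go (h ∘ suc)
  ... | suc _ = cong suc (go (h ∘ suc))

both : (i j x y : Fin 3) → ℕ
both i j x y with (x ≟ i) ×-dec (y ≟ j)
... | yes _ = 1
... | no  _ = 0

both≤1 : ∀ i j x y → both i j x y ≤ 1
both≤1 i j x y with (x ≟ i) ×-dec (y ≟ j)
... | yes _ = ≤-refl
... | no  _ = z≤n

both-sound : ∀ i j x y → both i j x y ≢ 0 → x ≡ i × y ≡ j
both-sound i j x y ≢0 with (x ≟ i) ×-dec (y ≟ j)
... | yes p = p
... | no  _ = contradiction refl ≢0

both-complete : ∀ i j x y → x ≡ i → y ≡ j → both i j x y ≡ 1
both-complete i j x y x≡i y≡j with (x ≟ i) ×-dec (y ≟ j)
... | yes _ = refl
... | no ¬p = contradiction (x≡i , y≡j) ¬p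

module _ (f g : Fin n → Fin 3) where

  common : Fin 3 → Fin 3 → ℕ
  common i j = sum (λ v → both i j (f v) (g v))

  -- Inclusion–exclusion, with the common zeros moved to the left so that no subtraction occurs.
  weights+missed : weight f + weight g + common zero zero
                 ≡ n + ((common c₁ c₁ + common c₁ c₂) + (common c₂ c₁ + common c₂ c₂))
  weights+missed = begin
    weight f + weight g + common zero zero
      ≡⟨ cong (_+ common zero zero) (cong₂ _+_ (weight≡sum f) (weight≡sum g)) ⟩
    sum (nonzero ∘ f) + sum (nonzero ∘ g) + common zero zero
      ≡⟨ cong (_+ common zero zero) (∑-distrib-+ (nonzero ∘ f) (nonzero ∘ g)) ⟨
    sum (λ v → nonzero (f v) + nonzero (g v)) + common zero zero
      ≡⟨ ∑-distrib-+ (λ v → nonzero (f v) + nonzero (g v)) (b zero zero) ⟨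
    sum (λ v → nonzero (f v) + nonzero (g v) + b zero zero v)
      ≡⟨ sum-cong-≗ (λ v → pointwise (f v) (g v)) ⟩
    sum (λ v → 1 + ((b c₁ c₁ v + b c₁ c₂ v) + (b c₂ c₁ v + b c₂ c₂ v)))
      ≡⟨ ∑-distrib-+ (const 1) (λ v → (b c₁ c₁ v + b c₁ c₂ v) + (b c₂ c₁ v + b c₂ c₂ v)) ⟩
    sum {n} (const 1) + sum (λ v → (b c₁ c₁ v + b c₁ c₂ v) + (b c₂ c₁ v + b c₂ c₂ v))
      ≡⟨ cong₂ _+_ (sum-ones n) (∑-distrib-+ (λ v → b c₁ c₁ v + b c₁ c₂ v) (λ v → b c₂ c₁ v + b c₂ c₂ v)) ⟩
    n + (sum (λ v → b c₁ c₁ v + b c₁ c₂ v) + sum (λ v → b c₂ c₁ v + b c₂ c₂ v))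
      ≡⟨ cong (n +_) (cong₂ _+_ (∑-distrib-+ (b c₁ c₁) (b c₁ c₂)) (∑-distrib-+ (b c₂ c₁) (b c₂ c₂))) ⟩
    n + ((common c₁ c₁ + common c₁ c₂) + (common c₂ c₁ + common c₂ c₂)) ∎
    where
    open ≡-Reasoning
    b : Fin 3 → Fin 3 → Fin n → ℕ
    b i j v = both i j (f v) (g v)
    pointwise : ∀ x y → nonzero x + nonzero y + both zero zero x y
              ≡ 1 + ((both c₁ c₁ x y + both c₁ c₂ x y) + (both c₂ c₁ x y + both c₂ c₂ x y))
    pointwise zero zero = refl
    pointwise zero c₁   = refl
    pointwise zero c₂   = refl
    pointwise c₁   zero = refl
    pointwise c₁   c₁   = refl
    pointwise c₁   c₂   = refl
    pointwise c₂   zero = refl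
    pointwise c₂   c₁   = refl
    pointwise c₂   c₂   = refl

  common-empty : ∀ {i j} → (∀ v → f v ≡ i → g v ≡ j → ⊥) → common i j ≤ 0
  common-empty {i} {j} empty = ≤-reflexive (sum-zero _ λ v → at v)
    where
    at : ∀ v → both i j (f v) (g v) ≡ 0
    at v with (f v ≟ i) ×-dec (g v ≟ j)
    ... | yes (p , q) = ⊥-elim (empty v p q)
    ... | no  _       = refl

  missed≥1 : ∀ {v} → f v ≡ zero → g v ≡ zero → 1 ≤ common zero zero
  missed≥1 {v} fv gv = subst (_≤ common zero zero)
    (both-complete zero zero (f v) (g v) fv gv) (term≤sum _ v)

  missed≥2 : ∀ {u v} → u ≢ v → f u ≡ zero → g u ≡ zero → f v ≡ zero → g v ≡ zero →
             2 ≤ common zero zero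
  missed≥2 {u} {v} u≢v fu gu fv gv = subst (_≤ common zero zero)
    (cong₂ _+_ (both-complete zero zero (f u) (g u) fu gu) (both-complete zero zero (f v) (g v) fv gv))
    (two-terms≤sum _ u v u≢v)

  -- Used with `k` equal to 2, 1 or 0, when none, one or two of the four intersections are known to
  -- be empty.
  weights≤n+2 : ∀ k → k ≤ common zero zero →
    (common c₁ c₁ + common c₁ c₂) + (common c₂ c₁ + common c₂ c₂) ≤ 2 + k →
    weight f + weight g ≤ n + 2
  weights≤n+2 k k≤missed commons≤ = +-cancelʳ-≤ k _ _ (begin
    weight f + weight g + k                   ≤⟨ +-monoʳ-≤ (weight f + weight g) k≤missed ⟩
    weight f + weight g + common zero zero   ≡⟨ weights+missed ⟩
    n + _                                     ≤⟨ +-monoʳ-≤ n commons≤ ⟩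
    n + (2 + k)                               ≡⟨ +-assoc n 2 k ⟨
    n + 2 + k                                 ∎)
    where open ≤-Reasoning

-- Extending partial colourings

module _ (G : SimpleGraph n) where

  Proper : (Fin n → Fin 3) → Set
  Proper f = ∀ i → i ≢ zero → ∀ u v → f u ≡ i → f v ≡ i → ¬ Adj G u v

  Dominated : (Fin n → Fin 3) → Fin n → Set
  Dominated f v = ∀ i → i ≢ zero → ∃[ u ] Adj G v u × f u ≡ i

-- In a partial colouring `zero` means uncoloured, so only nonzero values have to be kept.
_⊑_ : (f g : Fin n → Fin 3) → Set
f ⊑ g = ∀ v → f v ≢ zero → g v ≡ f v

⊑-trans : {f g h : Fin n → Fin 3} → f ⊑ g → g ⊑ h → f ⊑ h
⊑-trans f⊑g g⊑h v fv≢0 = trans (g⊑h v (subst (_≢ zero) (≡-sym (f⊑g v fv≢0)) fv≢0)) (f⊑g v fv≢0)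

⊑-colour : {f g : Fin n → Fin 3} → f ⊑ g → ∀ {i} → i ≢ zero → ∀ {v} → f v ≡ i → g v ≡ i
⊑-colour f⊑g i≢0 {v} refl = f⊑g v i≢0

module Greedy (G : SimpleGraph n) (adj? : ∀ u v → Dec (Adj G u v)) where

  dominated-mono : ∀ {f g v} → f ⊑ g → Dominated G f v → Dominated G g v
  dominated-mono f⊑g dom i i≢0 with dom i i≢0
  ... | u , vu , fu = u , vu , ⊑-colour f⊑g i≢0 fu

  recolour : ∀ {f} → Proper G f → ∀ {v} → f v ≡ zero → ∀ i → i ≢ zero →
             (∀ u → Adj G v u → f u ≢ i) →
             ∃[ g ] Proper G g × f ⊑ g × g v ≢ zero
  recolour {f} proper {v} fv≡0 i i≢0 free = g , g-proper , f⊑g , subst (_≢ zero) (≡-sym gv≡i) i≢0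
    where
    g : Fin n → Fin 3
    g = updateAt f v (const i)
    gv≡i : g v ≡ i
    gv≡i = updateAt-updates v f
    g-other : ∀ {u} → u ≢ v → g u ≡ f u
    g-other {u} = updateAt-minimal u v f
    f⊑g : f ⊑ g
    f⊑g u fu≢0 with u ≟ v
    ... | yes refl = contradiction fv≡0 fu≢0
    ... | no  u≢v  = g-other u≢v
    g-proper : Proper G g
    g-proper j j≢0 u w gu gw uw with u ≟ v | w ≟ v
    ... | yes refl | yes refl = irrefl G uw
    ... | yes refl | no  w≢v  = free w uw (trans (≡-sym (g-other w≢v)) (trans gw (trans (≡-sym gu) gv≡i)))
    ... | no  u≢v  | yes refl = free u (sym G uw) (trans (≡-sym (g-other u≢v)) (trans gu (trans (≡-sym gw) gv≡i)))
    ... | no  u≢v  | no  w≢v  = proper j j≢0 u w (trans (≡-sym (g-other u≢v)) gu) (trans (≡-sym (g-other w≢v)) gw) uw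

  -- If `v` is uncoloured and not dominated, some colour is absent from its neighbours, and `v` can
  -- take that colour.
  saturate-at : ∀ {f} → Proper G f → ∀ v →
                ∃[ g ] Proper G g × f ⊑ g × (g v ≡ zero → Dominated G g v)
  saturate-at {f} proper v with f v ≟ zero
  ... | no  fv≢0 = f , proper , (λ _ _ → refl) , λ fv≡0 → contradiction fv≡0 fv≢0
  ... | yes fv≡0 with any? (λ u → adj? v u ×-dec (f u ≟ c₁)) | any? (λ u → adj? v u ×-dec (f u ≟ c₂))
  ...   | yes d₁ | yes d₂ = f , proper , (λ _ _ → refl) , λ _ →
                            λ { zero 0≢0 → contradiction refl 0≢0 ; c₁ _ → d₁ ; c₂ _ → d₂ }
  ...   | no ¬d₁ | _ with recolour proper fv≡0 c₁ (λ ()) (λ u vu fu → ¬d₁ (u , vu , fu))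
  ...     | g , g-proper , f⊑g , gv≢0 = g , g-proper , f⊑g , λ gv≡0 → contradiction gv≡0 gv≢0
  saturate-at {f} proper v | yes fv≡0 | yes _ | no ¬d₂
    with recolour proper fv≡0 c₂ (λ ()) (λ u vu fu → ¬d₂ (u , vu , fu))
  ...     | g , g-proper , f⊑g , gv≢0 = g , g-proper , f⊑g , λ gv≡0 → contradiction gv≡0 gv≢0

  -- One pass is enough: later steps only add colours, so a dominated vertex stays dominated and a
  -- coloured one stays coloured.
  saturate : ∀ {f} → Proper G f → ∀ vs →
             ∃[ g ] Proper G g × f ⊑ g × (∀ v → v ∈ vs → g v ≡ zero → Dominated G g v)
  saturate {f} proper [] = f , proper , (λ _ _ → refl) , λ _ ()
  saturate {f} proper (v ∷ vs) with saturate-at proper v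
  ... | g , g-proper , f⊑g , g-dom with saturate g-proper vs
  ...   | h , h-proper , g⊑h , h-dom = h , h-proper , ⊑-trans f⊑g g⊑h , dom
    where
    dom : ∀ u → u ∈ v ∷ vs → h u ≡ zero → Dominated G h u
    dom u (there u∈vs) hu≡0 = h-dom u u∈vs hu≡0
    dom u (here refl)  hu≡0 with g v ≟ zero
    ... | yes gv≡0 = dominated-mono g⊑h (g-dom gv≡0)
    ... | no  gv≢0 = contradiction (trans (≡-sym (g⊑h v gv≢0)) hu≡0) gv≢0

  extend : ∀ {f} → Proper G f → ∃[ g ] Is2RiDF G g × f ⊑ g
  extend proper with saturate proper (allFin n)
  ... | g , g-proper , f⊑g , g-dom =
    g , record { independent = g-proper ; dominating = λ v → g-dom v (∈-allFin v) } , f⊑g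

  Independent : (Fin n → Set) → Set
  Independent P = ∀ u v → P u → P v → ¬ Adj G u v

  -- The extension is not controlled outside the seeds; later claims about other vertices rest on
  -- the independence of the colour classes.
  extend-seeds : {A B : Fin n → Set} → Decidable A → Decidable B → (∀ v → A v → ¬ B v) →
                 Independent A → Independent B →
                 ∃[ f ] Is2RiDF G f × (∀ v → A v → f v ≡ c₁) × (∀ v → B v → f v ≡ c₂)
  extend-seeds {A} {B} A? B? disjoint indA indB =
    f , f-ridf , (λ v a → seeds⊑f′ (λ ()) (A⇒seeds v a)) , (λ v b → seeds⊑f′ (λ ()) (B⇒seeds v b))
    where
    seeds : Fin n → Fin 3
    seeds v with A? v | B? v
    ... | yes _ | _     = c₁
    ... | no  _ | yes _ = c₂
    ... | no  _ | no  _ = zero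
    A⇒seeds : ∀ v → A v → seeds v ≡ c₁
    A⇒seeds v a with A? v
    ... | yes _ = refl
    ... | no ¬a = contradiction a ¬a
    B⇒seeds : ∀ v → B v → seeds v ≡ c₂
    B⇒seeds v b with A? v | B? v
    ... | yes a | _     = contradiction b (disjoint v a)
    ... | no  _ | yes _ = refl
    ... | no  _ | no ¬b = contradiction b ¬b
    seeds⇒A : ∀ v → seeds v ≡ c₁ → A v
    seeds⇒A v e with A? v | B? v
    seeds⇒A v e  | yes a | _     = a
    seeds⇒A v () | no  _ | yes _
    seeds⇒A v () | no  _ | no  _
    seeds⇒B : ∀ v → seeds v ≡ c₂ → B v
    seeds⇒B v e with A? v | B? v
    seeds⇒B v () | yes _ | _
    seeds⇒B v e  | no  _ | yes b = b
    seeds⇒B v () | no  _ | no  _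
    seeds-proper : Proper G seeds
    seeds-proper zero 0≢0 = contradiction refl 0≢0
    seeds-proper c₁ _ u v su sv = indA u v (seeds⇒A u su) (seeds⇒A v sv)
    seeds-proper c₂ _ u v su sv = indB u v (seeds⇒B u su) (seeds⇒B v sv)
    extension : ∃[ f ] Is2RiDF G f × seeds ⊑ f
    extension = extend seeds-proper
    f : Fin n → Fin 3
    f = proj₁ extension
    f-ridf : Is2RiDF G f
    f-ridf = proj₁ (proj₂ extension)
    seeds⊑f′ : ∀ {i} → i ≢ zero → ∀ {v} → seeds v ≡ i → f v ≡ i
    seeds⊑f′ = ⊑-colour (proj₂ (proj₂ extension))

-- A graph and its complement, treated symmetrically

-- A relation rather than the operation `complement`, so that the two graphs can be exchanged. Its
-- field `cover` also decides adjacency.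
record Complementary (G H : SimpleGraph n) : Set where
  field
    cover     : ∀ u v → u ≢ v → Adj G u v ⊎ Adj H u v
    exclusive : ∀ {u v} → Adj G u v → ¬ Adj H u v

dual : {G H : SimpleGraph n} → Complementary G H → Complementary H G
dual c = record
  { cover     = λ u v u≢v → swap (Complementary.cover c u v u≢v)
  ; exclusive = λ h g → Complementary.exclusive c g h
  }

Cheap : (G H : SimpleGraph n) → Set
Cheap {n} G H = ∃[ f ] ∃[ g ] Is2RiDF G f × Is2RiDF H g × weight f + weight g ≤ n + 2

cheap-dual : {G H : SimpleGraph n} → Cheap G H → Cheap H G
cheap-dual (f , g , rf , rg , w≤) = g , f , rg , rf , ≤-trans (≤-reflexive (+-comm (weight g) (weight f))) w≤

adj⇒≢ : (G : SimpleGraph n) → ∀ {u v} → Adj G u v → u ≢ v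
adj⇒≢ G uv refl = irrefl G uv

-- Either nonzero colour at `v` would clash with `x` or with `y`. This forces a chosen vertex to be
-- missed by a greedy extension.
sees-both⇒zero : {G : SimpleGraph n} {f : Fin n → Fin 3} → Is2RiDF G f → ∀ {v x y} →
                 Adj G v x → Adj G v y → f x ≡ c₁ → f y ≡ c₂ → f v ≡ zero
sees-both⇒zero {f = f} rf {v} {x} {y} vx vy fx fy with f v in fv
... | zero = refl
... | c₁   = contradiction vx (Is2RiDF.independent rf c₁ (λ ()) v x fv fx)
... | c₂   = contradiction vy (Is2RiDF.independent rf c₂ (λ ()) v y fv fy)

-- The condition under which some 2RiDF of G assigns 0 to both w and v:
-- a colour class can contain {u₁, x₁} and the other one {u₂, x₂}.
record JointlyDominable (G : SimpleGraph n) (w v : Fin n) : Set where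
  constructor jointly
  field
    {u₁ x₁ u₂ x₂} : Fin n
    wu₁ : Adj G w u₁
    vx₁ : Adj G v x₁
    ind₁ : ¬ Adj G u₁ x₁
    wu₂ : Adj G w u₂
    vx₂ : Adj G v x₂
    ind₂ : ¬ Adj G u₂ x₂
    u₁≢u₂ : u₁ ≢ u₂
    u₁≢x₂ : u₁ ≢ x₂
    x₁≢u₂ : x₁ ≢ u₂
    x₁≢x₂ : x₁ ≢ x₂

module Complements {G H : SimpleGraph n} (compl : Complementary G H) where
  open Complementary compl public

  adj? : ∀ u v → Dec (Adj G u v)
  adj? u v with u ≟ v
  ... | yes refl = no (irrefl G)
  ... | no  u≢v with cover u v u≢v
  ...   | inj₁ g = yes g
  ...   | inj₂ h = no λ g → exclusive g h

  open Greedy G adj? public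

  ¬adj⇒coadj : ∀ {u v} → u ≢ v → ¬ Adj G u v → Adj H u v
  ¬adj⇒coadj {u} {v} u≢v ¬g with cover u v u≢v
  ... | inj₁ g = contradiction g ¬g
  ... | inj₂ h = h

  separated : ∀ {w u v} → Adj G w u → Adj H w v → u ≢ v
  separated g h refl = exclusive g h

  -- Two distinct vertices are adjacent in `G` or in `H`, so they cannot share both a class of `f`
  -- and a class of `g`.
  common≤1 : ∀ {f g} → Is2RiDF G f → Is2RiDF H g → ∀ {i j} → i ≢ zero → j ≢ zero → common f g i j ≤ 1
  common≤1 {f} {g} rf rg {i} {j} i≢0 j≢0 = sum≤1 _ (λ v → both≤1 i j (f v) (g v)) unique
    where
    unique : ∀ u v → both i j (f u) (g u) ≢ 0 → both i j (f v) (g v) ≢ 0 → u ≡ v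
    unique u v bu bv with both-sound i j _ _ bu | both-sound i j _ _ bv | u ≟ v
    ... | _         | _         | yes u≡v = u≡v
    ... | fu , gu   | fv , gv   | no  u≢v with cover u v u≢v
    ...   | inj₁ uv = contradiction uv (Is2RiDF.independent rf i i≢0 u v fu fv)
    ...   | inj₂ uv = contradiction uv (Is2RiDF.independent rg j j≢0 u v gu gv)

  jointly⇒2RiDF : ∀ {w v} → JointlyDominable G w v →
                  ∃[ f ] Is2RiDF G f × f w ≡ zero × f v ≡ zero
  jointly⇒2RiDF (jointly {u₁} {x₁} {u₂} {x₂} wu₁ vx₁ i₁ wu₂ vx₂ i₂ d₁ d₂ d₃ d₄)
    with extend-seeds {λ v → v ≡ u₁ ⊎ v ≡ x₁} {λ v → v ≡ u₂ ⊎ v ≡ x₂}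
           (λ v → (v ≟ u₁) ⊎-dec (v ≟ x₁)) (λ v → (v ≟ u₂) ⊎-dec (v ≟ x₂)) disjoint
           (independent-pair i₁) (independent-pair i₂)
    where
    disjoint : ∀ v → v ≡ u₁ ⊎ v ≡ x₁ → ¬ (v ≡ u₂ ⊎ v ≡ x₂)
    disjoint v (inj₁ refl) (inj₁ e) = d₁ e
    disjoint v (inj₁ refl) (inj₂ e) = d₂ e
    disjoint v (inj₂ refl) (inj₁ e) = d₃ e
    disjoint v (inj₂ refl) (inj₂ e) = d₄ e
    independent-pair : ∀ {u x} → ¬ Adj G u x → Independent (λ v → v ≡ u ⊎ v ≡ x)
    independent-pair ¬ux _ _ (inj₁ refl) (inj₁ refl) = irrefl G
    independent-pair ¬ux _ _ (inj₁ refl) (inj₂ refl) = ¬ux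
    independent-pair ¬ux _ _ (inj₂ refl) (inj₁ refl) = ¬ux ∘ sym G
    independent-pair ¬ux _ _ (inj₂ refl) (inj₂ refl) = irrefl G
  ... | f , rf , fA , fB =
    f , rf , sees-both⇒zero rf wu₁ wu₂ (fA _ (inj₁ refl)) (fB _ (inj₁ refl))
           , sees-both⇒zero rf vx₁ vx₂ (fA _ (inj₂ refl)) (fB _ (inj₂ refl))

  -- A common neighbour of `w` and `v` serves a whole class alone, since `u₁` and `x₁` may coincide.
  -- This lemma and the next two treat the cases of two, one and no class of this kind.
  two-common : ∀ {w v s t} → Adj G w s → Adj G v s → Adj G w t → Adj G v t → s ≢ t →
               JointlyDominable G w v
  two-common ws vs wt vt s≢t = jointly ws vs (irrefl G) wt vt (irrefl G) s≢t s≢t s≢t s≢t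

  one-common : ∀ {w v s u x} → Adj G w s → Adj G v s → Adj G w u → Adj G v x → Adj H u x →
               s ≢ u → s ≢ x → JointlyDominable G w v
  one-common ws vs wu vx ux s≢u s≢x =
    jointly ws vs (irrefl G) wu vx (λ g → exclusive g ux) s≢u s≢x s≢u s≢x

  none-common : ∀ {w v u x u′ x′} → Adj G w u → Adj G v x → Adj H u x →
                Adj G w u′ → Adj G v x′ → Adj H u′ x′ →
                u ≢ u′ → u ≢ x′ → x ≢ u′ → x ≢ x′ → JointlyDominable G w v
  none-common wu vx ux wu′ vx′ u′x′ = jointly wu vx (λ g → exclusive g ux) wu′ vx′ (λ g → exclusive g u′x′)

-- The two missed vertices `w` and `v` pay for all four intersections being possibly nonempty.
jointly-both⇒cheap : {G H : SimpleGraph n} → Complementary G H → ∀ {w v} → w ≢ v →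
                     JointlyDominable G w v → JointlyDominable H w v → Cheap G H
jointly-both⇒cheap compl w≢v jG jH
  with Complements.jointly⇒2RiDF compl jG | Complements.jointly⇒2RiDF (dual compl) jH
... | f , rf , fw , fv | g , rg , gw , gv =
  f , g , rf , rg , weights≤n+2 f g 2 (missed≥2 f g w≢v fw gw fv gv)
    (+-mono-≤ (+-mono-≤ (≤1 (λ ()) (λ ())) (≤1 (λ ()) (λ ()))) (+-mono-≤ (≤1 (λ ()) (λ ())) (≤1 (λ ()) (λ ()))))
  where
  ≤1 : ∀ {i j} → i ≢ zero → j ≢ zero → common f g i j ≤ 1
  ≤1 = Complements.common≤1 compl rf rg

-- Nested neighbourhoods: N(v₂) ⊆ N[v₁]

Nested : (G H : SimpleGraph n) → (v₁ v₂ : Fin n) → Set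
Nested G H v₁ v₂ = ∀ z → Adj G v₂ z → ¬ Adj H v₁ z

-- Nestedness passes to the complement with the two vertices exchanged, so each construction below
-- is available in `H` too.
nested-dual : {G H : SimpleGraph n} → ∀ {v₁ v₂} → Nested G H v₁ v₂ → Nested H G v₂ v₁
nested-dual nested z h g = nested z g h

record Anchored (G : SimpleGraph n) (v₁ v₂ : Fin n) (f : Fin n → Fin 3) : Set where
  constructor anchored
  field
    ridf : Is2RiDF G f
    at₁  : f v₁ ≡ c₁
    at₂  : f v₂ ≡ c₂

module NestedPair {G H : SimpleGraph n} (compl : Complementary G H) {v₁ v₂ : Fin n}
                  (v₁≢v₂ : v₁ ≢ v₂) (nested : Nested G H v₁ v₂) where
  open Complements compl
  module Co = Complements (dual compl)

  private
    -- Sharing the `f`-class of `v₁` makes `v` adjacent to `v₁` in `H`, and sharing the `g`-class of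
    -- `v₂` makes it adjacent to `v₂` in `G`, against nestedness.
    no-1-2 : ∀ {f g} → Anchored G v₁ v₂ f → Anchored H v₁ v₂ g → ∀ v → f v ≡ c₁ → g v ≡ c₂ → ⊥
    no-1-2 (anchored rf f₁ f₂) (anchored rg g₁ g₂) v fv gv = nested v
      (Co.¬adj⇒coadj v₂≢v (λ h → Is2RiDF.independent rg c₂ (λ ()) v₂ v g₂ gv h))
      (¬adj⇒coadj v₁≢v (λ g → Is2RiDF.independent rf c₁ (λ ()) v₁ v f₁ fv g))
      where
      v₁≢v : v₁ ≢ v
      v₁≢v refl with trans (≡-sym g₁) gv
      ... | ()
      v₂≢v : v₂ ≢ v
      v₂≢v refl with trans (≡-sym f₂) fv
      ... | ()

  missed⇒cheap : ∀ {f g} → Anchored G v₁ v₂ f → Anchored H v₁ v₂ g →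
                 ∀ {m} → f m ≡ zero → g m ≡ zero → Cheap G H
  missed⇒cheap {f} {g} af ag fm gm =
    f , g , Anchored.ridf af , Anchored.ridf ag , weights≤n+2 f g 1 (missed≥1 f g fm gm)
      (+-mono-≤ (+-mono-≤ (≤1 (λ ()) (λ ())) (common-empty f g (no-1-2 af ag)))
                (+-mono-≤ (≤1 (λ ()) (λ ())) (≤1 (λ ()) (λ ()))))
    where
    ≤1 : ∀ {i j} → i ≢ zero → j ≢ zero → common f g i j ≤ 1
    ≤1 = common≤1 (Anchored.ridf af) (Anchored.ridf ag)

  -- A vertex of this intersection is automatically adjacent to `v₁` and not to `v₂`, so only such
  -- vertices have to be excluded. Two empty intersections then suffice.
  no-2-1⇒cheap : ∀ {f g} → Anchored G v₁ v₂ f → Anchored H v₁ v₂ g →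
                 (∀ r → Adj G v₁ r → Adj H v₂ r → f r ≡ c₂ → g r ≡ c₁ → ⊥) → Cheap G H
  no-2-1⇒cheap {f} {g} af@(anchored rf f₁ f₂) ag@(anchored rg g₁ g₂) empty =
    f , g , rf , rg , weights≤n+2 f g 0 z≤n
      (+-mono-≤ (+-mono-≤ (≤1 (λ ()) (λ ())) (common-empty f g (no-1-2 af ag)))
                (+-mono-≤ (common-empty f g no-2-1) (≤1 (λ ()) (λ ()))))
    where
    ≤1 : ∀ {i j} → i ≢ zero → j ≢ zero → common f g i j ≤ 1
    ≤1 = common≤1 rf rg
    no-2-1 : ∀ v → f v ≡ c₂ → g v ≡ c₁ → ⊥
    no-2-1 v fv gv = empty v
      (Co.¬adj⇒coadj v₁≢v (λ h → Is2RiDF.independent rg c₁ (λ ()) v₁ v g₁ gv h))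
      (¬adj⇒coadj v₂≢v (λ g → Is2RiDF.independent rf c₂ (λ ()) v₂ v f₂ fv g)) fv gv
      where
      v₁≢v : v₁ ≢ v
      v₁≢v refl with trans (≡-sym f₁) fv
      ... | ()
      v₂≢v : v₂ ≢ v
      v₂≢v refl with trans (≡-sym g₂) gv
      ... | ()

  -- Colouring q′ with 1 and r with 2 leaves q uncoloured in both graphs.
  outer-edge⇒cheap : ∀ {q q′ r} → Adj H v₁ q → Adj H v₂ q → Adj H v₁ q′ → Adj H v₂ q′ → Adj G q q′ →
                     Adj G v₁ r → Adj H v₂ r → Adj G q r → Cheap G H
  outer-edge⇒cheap {q} {q′} {r} v₁q v₂q v₁q′ v₂q′ qq′ v₁r v₂r qr
    with extend-seeds {λ v → v ≡ v₁ ⊎ v ≡ q′} {λ v → v ≡ v₂ ⊎ v ≡ r}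
           (λ v → (v ≟ v₁) ⊎-dec (v ≟ q′)) (λ v → (v ≟ v₂) ⊎-dec (v ≟ r)) disjoint
           (coadj-pair v₁q′) (coadj-pair v₂r)
       | Co.extend-seeds {_≡ v₁} {_≡ v₂} (_≟ v₁) (_≟ v₂) (λ { v refl e → v₁≢v₂ e })
           (λ { _ _ refl refl → irrefl H }) (λ { _ _ refl refl → irrefl H })
    where
    disjoint : ∀ v → v ≡ v₁ ⊎ v ≡ q′ → ¬ (v ≡ v₂ ⊎ v ≡ r)
    disjoint v (inj₁ refl) (inj₁ e)    = v₁≢v₂ e
    disjoint v (inj₁ refl) (inj₂ refl) = irrefl G v₁r
    disjoint v (inj₂ refl) (inj₁ refl) = irrefl H v₂q′
    disjoint v (inj₂ refl) (inj₂ refl) = exclusive v₁r v₁q′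
    coadj-pair : ∀ {u x} → Adj H u x → Independent (λ v → v ≡ u ⊎ v ≡ x)
    coadj-pair ux _ _ (inj₁ refl) (inj₁ refl) = irrefl G
    coadj-pair ux _ _ (inj₁ refl) (inj₂ refl) = λ g → exclusive g ux
    coadj-pair ux _ _ (inj₂ refl) (inj₁ refl) = λ g → exclusive g (sym H ux)
    coadj-pair ux _ _ (inj₂ refl) (inj₂ refl) = irrefl G
  ... | f , rf , fA , fB | g , rg , gA , gB =
    missed⇒cheap (anchored rf (fA _ (inj₁ refl)) (fB _ (inj₁ refl))) (anchored rg (gA _ refl) (gB _ refl))
      (sees-both⇒zero rf qq′ qr (fA _ (inj₂ refl)) (fB _ (inj₂ refl)))
      (sees-both⇒zero rg (sym H v₁q) (sym H v₂q) (gA _ refl) (gB _ refl))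

  Distinguisher : Fin n → Set
  Distinguisher r = Adj G v₁ r × Adj H v₂ r

  -- Seeding `f` with the `Outer` vertices in colour 2 keeps their adjacent distinguishers out of
  -- that colour; seeding `g` with the `Inner` vertices in colour 1 does the same in `H`. Exchanging
  -- `G` with `H` and `v₁` with `v₂` exchanges the two sets.
  Outer Inner : Fin n → Set
  Outer q = (Adj H v₁ q × Adj H v₂ q) × ∃[ r ] Distinguisher r × Adj G q r
  Inner p = (Adj G v₁ p × Adj G v₂ p) × ∃[ r ] Distinguisher r × Adj H p r

  -- With these seeds, a distinguisher that has colour 2 in `f` and colour 1 in `g` is necessarily
  -- of this kind.
  Helpless : Fin n → Set
  Helpless r = (∀ q → Adj H v₁ q → Adj H v₂ q → ¬ Adj G q r) × (∀ p → Adj G v₁ p → Adj G v₂ p → ¬ Adj H p r)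

module _ {G H : SimpleGraph n} (compl : Complementary G H) (¬cheap : ¬ Cheap G H) where

  -- The colourings are seeded with the `Outer` and `Inner` vertices. If two `Outer` vertices are
  -- adjacent, or two `Inner` ones nonadjacent, other seeds miss a vertex; otherwise only a helpless
  -- distinguisher can lie in the intersection that has to be empty.
  no-nested : ∀ {v₁ v₂} → v₁ ≢ v₂ → ¬ Nested G H v₁ v₂
  no-nested {v₁} {v₂} v₁≢v₂ nested = go (allFin n) (<-wellFounded _) v₁≢v₂ nested (λ r _ _ → ∈-allFin r)
    where
    -- The list contains all vertices distinguishing the pair; a helpless one yields
    -- a nested pair with fewer distinguishers.
    go : ∀ L → Acc _<_ (length L) → ∀ {v₁ v₂} → v₁ ≢ v₂ → Nested G H v₁ v₂ →
         (∀ r → Adj G v₁ r → Adj H v₂ r → r ∈ L) → ⊥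
    go L (acc smaller) {v₁} {v₂} v₁≢v₂ nested inL = ¬cheap cheap
      where
      open Complements compl
      open NestedPair compl v₁≢v₂ nested
      module Dual = NestedPair (dual compl) (v₁≢v₂ ∘ ≡-sym) (nested-dual {G = G} {H} nested)

      -- A helpless `r` can replace `v₁` if `v₁` and `v₂` are adjacent, and `v₂` otherwise: the pair
      -- stays nested, gains no distinguisher and loses `r`.
      ¬helpless : ∀ {r} → Adj G v₁ r → Adj H v₂ r → ¬ Helpless r
      ¬helpless {r} v₁r v₂r (no-q , no-p) = recurse (cover v₁ v₂ v₁≢v₂)
        where
        ≢r? : ∀ x → Dec (x ≢ r)
        ≢r? x = ¬? (x ≟ r)
        step : ∀ {w₁ w₂} → w₁ ≢ w₂ → Nested G H w₁ w₂ →
               (∀ x → Adj G w₁ x → Adj H w₂ x → (Adj G v₁ x × Adj H v₂ x) × x ≢ r) → ⊥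
        step w₁≢w₂ nested′ shrink =
          go (filter ≢r? L) (smaller (filter-notAll ≢r? L (lose (inL r v₁r v₂r) (λ r≢r → r≢r refl))))
            w₁≢w₂ nested′ λ x w₁x w₂x → let ((v₁x , v₂x) , x≢r) = shrink x w₁x w₂x in
              ∈-filter⁺ ≢r? (inL x v₁x v₂x) x≢r

        recurse : Adj G v₁ v₂ ⊎ Adj H v₁ v₂ → ⊥
        recurse (inj₁ v₁v₂) = step {r} {v₂} (adj⇒≢ H v₂r ∘ ≡-sym) nested′ shrink
          where
          nested′ : Nested G H r v₂
          nested′ z v₂z rz with cover v₁ z (λ { refl → exclusive v₁r (sym H rz) })
          ... | inj₁ v₁z = no-p z v₁z v₂z (sym H rz)
          ... | inj₂ v₁z = nested z v₂z v₁z
          shrink : ∀ x → Adj G r x → Adj H v₂ x → (Adj G v₁ x × Adj H v₂ x) × x ≢ r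
          shrink x rx v₂x with cover v₁ x (λ { refl → exclusive v₁v₂ (sym H v₂x) })
          ... | inj₁ v₁x = (v₁x , v₂x) , adj⇒≢ G rx ∘ ≡-sym
          ... | inj₂ v₁x = ⊥-elim (no-q x v₁x v₂x (sym G rx))
        recurse (inj₂ v₁v₂) = step {v₁} {r} (adj⇒≢ G v₁r) nested′ shrink
          where
          nested′ : Nested G H v₁ r
          nested′ z rz v₁z with cover v₂ z (λ { refl → exclusive (sym G rz) v₂r })
          ... | inj₁ v₂z = nested z v₂z v₁z
          ... | inj₂ v₂z = no-q z v₁z v₂z (sym G rz)
          shrink : ∀ x → Adj G v₁ x → Adj H r x → (Adj G v₁ x × Adj H v₂ x) × x ≢ r
          shrink x v₁x rx with cover v₂ x (λ { refl → exclusive v₁x v₁v₂ })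
          ... | inj₁ v₂x = ⊥-elim (no-p x v₁x v₂x (sym H rx))
          ... | inj₂ v₂x = (v₁x , v₂x) , adj⇒≢ H rx ∘ ≡-sym

      coadj? : ∀ u v → Dec (Adj H u v)
      coadj? = Complements.adj? (dual compl)

      distinguisher? : Decidable Distinguisher
      distinguisher? r = adj? v₁ r ×-dec coadj? v₂ r

      outer? : Decidable Outer
      outer? q = (coadj? v₁ q ×-dec coadj? v₂ q) ×-dec any? (λ r → distinguisher? r ×-dec adj? q r)

      inner? : Decidable Inner
      inner? p = (adj? v₁ p ×-dec adj? v₂ p) ×-dec any? (λ r → distinguisher? r ×-dec coadj? p r)

      cheap : Cheap G H
      cheap with extend-seeds {_≡ v₁} {λ v → v ≡ v₂ ⊎ Outer v} (_≟ v₁) (λ v → (v ≟ v₂) ⊎-dec outer? v)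
                   (λ { v refl (inj₁ e) → v₁≢v₂ e ; v refl (inj₂ ((v₁v₁ , _) , _)) → irrefl H v₁v₁ })
                   (λ { _ _ refl refl → irrefl G }) outer-independent
               | Co.extend-seeds {λ v → v ≡ v₁ ⊎ Inner v} {_≡ v₂} (λ v → (v ≟ v₁) ⊎-dec inner? v) (_≟ v₂)
                   (λ { v (inj₁ e) refl → v₁≢v₂ (≡-sym e) ; v (inj₂ ((_ , v₂v₂) , _)) refl → irrefl G v₂v₂ })
                   inner-clique (λ { _ _ refl refl → irrefl H })
        where
        outer-independent : Independent (λ v → v ≡ v₂ ⊎ Outer v)
        outer-independent _ _ (inj₁ refl) (inj₁ refl) e = irrefl G e
        outer-independent _ _ (inj₁ refl) (inj₂ ((_ , v₂v) , _)) e = exclusive e v₂v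
        outer-independent _ _ (inj₂ ((_ , v₂u) , _)) (inj₁ refl) e = exclusive e (sym H v₂u)
        outer-independent _ _ (inj₂ ((v₁u , v₂u) , r , (v₁r , v₂r) , ur)) (inj₂ ((v₁v , v₂v) , _)) e =
          ¬cheap (outer-edge⇒cheap v₁u v₂u v₁v v₂v e v₁r v₂r ur)
        inner-clique : Co.Independent (λ v → v ≡ v₁ ⊎ Inner v)
        inner-clique _ _ (inj₁ refl) (inj₁ refl) e = irrefl H e
        inner-clique _ _ (inj₁ refl) (inj₂ ((v₁v , _) , _)) e = exclusive v₁v e
        inner-clique _ _ (inj₂ ((v₁u , _) , _)) (inj₁ refl) e = exclusive (sym G v₁u) e
        inner-clique _ _ (inj₂ ((v₁u , v₂u) , r , (v₁r , v₂r) , ur)) (inj₂ ((v₁v , v₂v) , _)) e =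
          ¬cheap (cheap-dual (Dual.outer-edge⇒cheap v₂u v₁u v₂v v₁v e v₂r v₁r ur))
      ... | f , rf , fA , fB | g , rg , gA , gB =
        no-2-1⇒cheap (anchored rf (fA v₁ refl) (fB v₂ (inj₁ refl))) (anchored rg (gA v₁ (inj₁ refl)) (gB v₂ refl))
          λ r v₁r v₂r fr gr → ¬helpless v₁r v₂r
            ( (λ q v₁q v₂q qr → Is2RiDF.independent rf c₂ (λ ()) q r
                 (fB q (inj₂ ((v₁q , v₂q) , r , (v₁r , v₂r) , qr))) fr qr)
            , (λ p v₁p v₂p pr → Is2RiDF.independent rg c₁ (λ ()) p r
                 (gA p (inj₂ ((v₁p , v₂p) , r , (v₁r , v₂r) , pr))) gr pr))

  -- The positive form of `no-nested`: some neighbour of `x` lies outside the closed neighbourhood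
  -- of `y`.
  escape : ∀ {x y} → x ≢ y → ∃[ z ] Adj G x z × Adj H y z
  escape {x} {y} x≢y with any? (λ z → Complements.adj? compl x z ×-dec Complements.adj? (dual compl) y z)
  ... | yes e = e
  ... | no ¬e = ⊥-elim (no-nested (x≢y ∘ ≡-sym) λ z xz yz → ¬e (z , xz , yz))

-- No nested pairs and no jointly dominable pairs: every degree is 2

module Irreducible {G H : SimpleGraph n} (compl : Complementary G H)
  (escape : ∀ {x y} → x ≢ y → ∃[ z ] Adj G x z × Adj H y z)
  (conflict : ∀ {w v} → w ≢ v → JointlyDominable G w v → ¬ JointlyDominable H w v) where

  open Complements compl
  private
    module Co = Complements (dual compl)
    E N : Fin n → Fin n → Set
    E = Adj G
    N = Adj H

  coseparated : ∀ {w u v} → N w u → E w v → u ≢ v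
  coseparated = Co.separated

  -- Refutes a jointly dominable edge at a vertex `w` of degree at least 3, the degree being
  -- expressed by `third`. In the names, far means nonadjacent to `w`, and missed means adjacent to
  -- `w` but not to `u`.
  module JointlyDominableNeighbour {w u : Fin n} (wu : E w u) (joint : JointlyDominable G w u)
    (third : ∀ a b → ∃[ t ] E w t × t ≢ a × t ≢ b) where

    ¬cojoint : ¬ JointlyDominable H w u
    ¬cojoint = conflict (adj⇒≢ G wu) joint

    -- Here a common nonneighbour `q` of `w` and `u` is refuted. It is the only one, and every
    -- missed vertex is adjacent to `q` but to no other far vertex.
    module CommonNonNeighbour {q : Fin n} (wq : N w q) (uq : N u q) where

      q≢w : q ≢ w
      q≢w = adj⇒≢ H wq ∘ ≡-sym

      far⇒adj-u : ∀ {z} → N w z → z ≢ q → E u z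
      far⇒adj-u {z} wz z≢q with cover u z (separated wu wz)
      ... | inj₁ uz = uz
      ... | inj₂ uz = ⊥-elim (¬cojoint (Co.two-common wq uq wz uz (z≢q ∘ ≡-sym)))

      -- An edge `vz` would make `w` and `u` jointly dominable in `H`, with `q` in one class and
      -- `z`, `v` in the other.
      missed-anti-far : ∀ {v z} → E w v → N u v → N w z → z ≢ q → N v z
      missed-anti-far {v} {z} wv uv wz z≢q with cover v z (separated wv wz)
      ... | inj₁ vz = ⊥-elim (¬cojoint (Co.one-common wq uq wz uv (sym G vz) (z≢q ∘ ≡-sym) (coseparated wq wv)))
      ... | inj₂ vz = vz

      missed-adj-q : ∀ {v} → E w v → N u v → E v q
      missed-adj-q {v} wv uv with escape (adj⇒≢ G wv ∘ ≡-sym)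
      ... | z , vz , wz with z ≟ q
      ...   | yes refl = vz
      ...   | no  z≢q  = ⊥-elim (exclusive vz (missed-anti-far wv uv wz z≢q))

      z₀ : Fin n
      z₀ = proj₁ (escape q≢w)
      qz₀ : E q z₀
      qz₀ = proj₁ (proj₂ (escape q≢w))
      wz₀ : N w z₀
      wz₀ = proj₂ (proj₂ (escape q≢w))
      z₀≢q : z₀ ≢ q
      z₀≢q = adj⇒≢ G qz₀ ∘ ≡-sym
      uz₀ : E u z₀
      uz₀ = far⇒adj-u wz₀ z₀≢q

      -- Thanks to `s`, the pair `w`, `u′` is jointly dominable in `G`, with classes `s` alone and
      -- `u` with `q`; so it is not in `H`.
      module MissedWithNeighbour {u′ s : Fin n} (wu′ : E w u′) (uu′ : N u u′) (ws : E w s) (u′s : E u′ s) where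

        ¬cojoint′ : ¬ JointlyDominable H w u′
        ¬cojoint′ = conflict (adj⇒≢ G wu′)
          (one-common ws u′s wu (missed-adj-q wu′ uu′) uq (separated u′s (sym H uu′)) (separated ws wq))

        far-two : ∀ {z} → N w z → z ≢ q → z ≡ z₀
        far-two {z} wz z≢q with z ≟ z₀
        ... | yes z≡z₀ = z≡z₀
        ... | no  z≢z₀ = ⊥-elim (¬cojoint′ (Co.two-common wz₀ (missed-anti-far wu′ uu′ wz₀ z₀≢q)
                                   wz (missed-anti-far wu′ uu′ wz z≢q) (z≢z₀ ∘ ≡-sym)))

        q-anti : ∀ {v} → E w v → N u′ v → ¬ E q v
        q-anti wv u′v qv = ¬cojoint′ (Co.one-common wz₀ (missed-anti-far wu′ uu′ wz₀ z₀≢q)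
                             wq u′v qv z₀≢q (coseparated wz₀ wv))

      private
        -- The escaping vertex cannot be far: both missed vertices see `q` and no other far vertex.
        missed-escape : ∀ {u′ u″} → E w u′ → N u u′ → E w u″ → N u u″ → u′ ≢ u″ →
                        ∃[ t ] E w t × E u′ t × N u″ t
        missed-escape wu′ uu′ wu″ uu″ u′≢u″ with escape u′≢u″
        ... | t , u′t , u″t with cover w t (separated (sym G wu″) u″t)
        ...   | inj₁ wt = t , wt , u′t , u″t
        ...   | inj₂ wt with t ≟ q
        ...     | yes refl = ⊥-elim (exclusive (missed-adj-q wu″ uu″) u″t)
        ...     | no  t≢q  = ⊥-elim (exclusive u′t (missed-anti-far wu′ uu′ wt t≢q))

      -- Two missed vertices would make `u` and `q` jointly dominable in both graphs.
      missed-unique : ∀ {u′ u″} → E w u′ → N u u′ → E w u″ → N u u″ → u′ ≡ u″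
      missed-unique {u′} {u″} wu′ uu′ wu″ uu″ with u′ ≟ u″
      ... | yes e = e
      ... | no  u′≢u″ with missed-escape wu′ uu′ wu″ uu″ u′≢u″ | missed-escape wu″ uu″ wu′ uu′ (u′≢u″ ∘ ≡-sym)
      ...   | t′ , wt′ , u′t′ , u″t′ | t″ , wt″ , u″t″ , u′t″ =
        ⊥-elim (conflict (adj⇒≢ H uq)
          (one-common uz₀ qz₀ ut″ (sym G (missed-adj-q wu′ uu′)) (sym H u′t″)
            (coseparated wz₀ wt″) (coseparated wz₀ wu′))
          (Co.none-common uu′ (sym H wq) (sym G wu′) uu″ qt″ u″t″
            u′≢u″ (adj⇒≢ H u′t″) (adj⇒≢ G wu″) (adj⇒≢ G wt″)))
        where
        open MissedWithNeighbour wu′ uu′ wt′ u′t′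
        qt″ : N q t″
        qt″ = ¬adj⇒coadj (coseparated wq wt″) (q-anti wt″ u′t″)
        ut″ : E u t″
        ut″ with cover u t″ (λ { refl → exclusive u″t″ (sym H uu″) })
        ... | inj₁ e = e
        ... | inj₂ e = ⊥-elim (exclusive (missed-adj-q wt″ e) (sym H qt″))

      u′ : Fin n
      u′ = proj₁ (escape (adj⇒≢ G wu))
      wu′ : E w u′
      wu′ = proj₁ (proj₂ (escape (adj⇒≢ G wu)))
      uu′ : N u u′
      uu′ = proj₂ (proj₂ (escape (adj⇒≢ G wu)))

      nonNeighbours-u : ∀ {x} → N u x → x ≡ u′ ⊎ x ≡ q
      nonNeighbours-u {x} ux with cover w x (separated (sym G wu) ux)
      ... | inj₁ wx = inj₁ (missed-unique wx ux wu′ uu′)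
      ... | inj₂ wx with x ≟ q
      ...   | yes x≡q = inj₂ x≡q
      ...   | no  x≢q = ⊥-elim (exclusive (far⇒adj-u wx x≢q) ux)

      -- An escape from `u` starting at `v` must end in `u′` or `q`, the only nonneighbours of `u`.
      ¬coadj-both : ∀ {v} → v ≢ u → N u′ v → ¬ N q v
      ¬coadj-both v≢u u′v qv with escape v≢u
      ... | x , vx , ux with nonNeighbours-u ux
      ...   | inj₁ refl = exclusive vx (sym H u′v)
      ...   | inj₂ refl = exclusive vx (sym H qv)

      -- Once `u′` has a neighbour adjacent to `w`, every neighbour `s` of `w` other than `u` and
      -- `u′` turns out to be adjacent to `u`, `u′`, `q` and `z₀`.
      module _ {s₀ : Fin n} (ws₀ : E w s₀) (u′s₀ : E u′ s₀) where
        open MissedWithNeighbour wu′ uu′ ws₀ u′s₀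

        module _ {s} (ws : E w s) (s≢u : s ≢ u) (s≢u′ : s ≢ u′) where

          adj-u : E u s
          adj-u with cover u s (s≢u ∘ ≡-sym)
          ... | inj₁ us = us
          ... | inj₂ us = contradiction (missed-unique ws us wu′ uu′) s≢u′

          adj-u′ : E u′ s
          adj-u′ with cover u′ s (s≢u′ ∘ ≡-sym)
          ... | inj₁ u′s = u′s
          ... | inj₂ u′s with cover q s (coseparated wq ws)
          ...   | inj₁ qs = ⊥-elim (q-anti ws u′s qs)
          ...   | inj₂ qs = ⊥-elim (¬coadj-both s≢u u′s qs)

          ¬cojoint-s : ¬ JointlyDominable H w s
          ¬cojoint-s = conflict (adj⇒≢ G ws)
            (two-common wu (sym G adj-u) wu′ (sym G adj-u′) (adj⇒≢ H uu′))

          avoids : ∀ {s′} → N s s′ → s′ ≢ u × s′ ≢ u′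
          avoids ss′ = coseparated ss′ (sym G adj-u) , coseparated ss′ (sym G adj-u′)

        module _ {s} (ws : E w s) (s≢u : s ≢ u) (s≢u′ : s ≢ u′) where
          private
            ¬cj : ¬ JointlyDominable H w s
            ¬cj = ¬cojoint-s ws s≢u s≢u′

          adj-q : E s q
          adj-q with cover s q (separated ws wq) | escape (adj⇒≢ G ws)
          ... | inj₁ sq | _ = sq
          ... | inj₂ sq | s′ , ws′ , ss′ with cover s z₀ (separated ws wz₀)
          ...   | inj₂ sz₀ = ⊥-elim (¬cj (Co.two-common wq sq wz₀ sz₀ (z₀≢q ∘ ≡-sym)))
          -- The pair `u`, `s` is jointly dominable in both graphs: by `w` and `z₀` in `G`, and by
          -- `q` together with `u′`, `s′` in `H`.
          ...   | inj₁ sz₀ = ⊥-elim (conflict (s≢u ∘ ≡-sym)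
            (two-common (sym G wu) (sym G ws) uz₀ sz₀ (adj⇒≢ H wz₀))
            (Co.one-common uq sq uu′ ss′
              (adj-u′ ws′ (proj₁ (avoids ws s≢u s≢u′ ss′)) (proj₂ (avoids ws s≢u s≢u′ ss′)))
              (coseparated wq wu′) (coseparated wq ws′)))

        module _ {s} (ws : E w s) (s≢u : s ≢ u) (s≢u′ : s ≢ u′) where
          private
            ¬cj : ¬ JointlyDominable H w s
            ¬cj = ¬cojoint-s ws s≢u s≢u′

          q-adj-coneighbour : ∀ {s′} → E w s′ → N s s′ → E q s′
          q-adj-coneighbour ws′ ss′ =
            sym G (adj-q ws′ (proj₁ (avoids ws s≢u s≢u′ ss′)) (proj₂ (avoids ws s≢u s≢u′ ss′)))

          adj-z₀ : E s z₀
          adj-z₀ with cover s z₀ (separated ws wz₀) | escape (adj⇒≢ G ws)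
          ... | inj₁ sz₀ | _ = sz₀
          ... | inj₂ sz₀ | s′ , ws′ , ss′ =
            ⊥-elim (¬cj (Co.one-common wz₀ sz₀ wq ss′ (q-adj-coneighbour ws′ ss′) z₀≢q (coseparated wz₀ ws′)))

        -- Two nonneighbours `s′` and `x` of `s` adjacent to `w`, paired with `q` and `z₀`, make `w`
        -- and `s` jointly dominable in `H`.
        contradictory-s : ∀ {s} → E w s → s ≢ u → s ≢ u′ → ⊥
        contradictory-s {s} ws s≢u s≢u′ with escape (adj⇒≢ G ws)
        ... | s′ , ws′ , ss′ with escape (adj⇒≢ H ss′ ∘ ≡-sym)
        ...   | x , s′x , sx with cover w x (separated (sym G ws) sx)
        ...     | inj₁ wx = ¬cojoint-s ws s≢u s≢u′
          (Co.none-common wq ss′ (q-adj-coneighbour ws s≢u s≢u′ ws′ ss′) wz₀ sx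
            (sym G (adj-z₀ wx (proj₁ (avoids ws s≢u s≢u′ sx)) (proj₂ (avoids ws s≢u s≢u′ sx))))
            (z₀≢q ∘ ≡-sym) (coseparated wq wx) (separated ws′ wz₀) (adj⇒≢ G s′x))
        ...     | inj₂ wx with x ≟ q
        ...       | yes refl = exclusive (adj-q ws s≢u s≢u′) sx
        ...       | no  x≢q  with far-two wx x≢q
        ...         | refl = exclusive (adj-z₀ ws s≢u s≢u′) sx

      -- In each surviving case `u′` has a neighbour adjacent to `w`: either `t` itself or the
      -- vertex `x` by which `u′` escapes `t`.
      impossible : ⊥
      impossible with third u u′
      ... | t , wt , t≢u , t≢u′ with cover u′ t (t≢u′ ∘ ≡-sym)
      ...   | inj₁ u′t = contradictory-s wt u′t wt t≢u t≢u′
      ...   | inj₂ u′t with cover q t (coseparated wq wt)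
      ...     | inj₂ qt = ¬coadj-both t≢u u′t qt
      ...     | inj₁ qt with escape (t≢u′ ∘ ≡-sym)
      ...       | x , u′x , tx with cover w x (separated (sym G wt) tx)
      ...         | inj₁ wx = contradictory-s wx u′x wt t≢u t≢u′
      ...         | inj₂ wx with x ≟ q
      ...           | yes refl = exclusive qt (sym H tx)
      ...           | no  x≢q  = exclusive u′x (missed-anti-far wu′ uu′ wx x≢q)

    far⇒adj-u : ∀ {z} → N w z → E u z
    far⇒adj-u {z} wz with cover u z (separated wu wz)
    ... | inj₁ uz = uz
    ... | inj₂ uz = ⊥-elim (CommonNonNeighbour.impossible wz uz)

    missed-near : ∀ {x} → N u x → E w x
    missed-near {x} ux with cover w x (separated (sym G wu) ux)
    ... | inj₁ wx = wx
    ... | inj₂ wx = ⊥-elim (exclusive (far⇒adj-u wx) ux)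

    -- With no common nonneighbour of `w` and `u` left, `q` is the only far neighbour of `u′` and of
    -- `u″`. Then `w` and `u′` are jointly dominable in both graphs.
    impossible : ⊥
    impossible with escape (adj⇒≢ G wu)
    ... | u′ , wu′ , uu′ with escape (adj⇒≢ H uu′ ∘ ≡-sym)
    ...   | u″ , u′u″ , uu″ with escape (adj⇒≢ G wu′ ∘ ≡-sym) | escape (adj⇒≢ G (missed-near uu″) ∘ ≡-sym)
    ...     | q , u′q , wq | q″ , u″q″ , wq″ = finish
      where
      wu″ : E w u″
      wu″ = missed-near uu″
      same : ∀ {z z′} → E u′ z → N w z → E u″ z′ → N w z′ → z ≡ z′
      same {z} {z′} u′z wz u″z′ wz′ with z ≟ z′
      ... | yes e = e
      ... | no z≢z′ = ⊥-elim (¬cojoint (Co.none-common wz uu′ (sym G u′z) wz′ uu″ (sym G u″z′)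
                        z≢z′ (coseparated wz wu″) (separated wu′ wz′) (adj⇒≢ G u′u″)))
      u″q : E u″ q
      u″q with same u′q wq u″q″ wq″
      ... | refl = u″q″
      finish : ⊥
      finish with escape (adj⇒≢ G u′u″) | escape (adj⇒≢ H wq ∘ ≡-sym)
      ... | t , u′t , u″t | z , qz , wz with cover w t (separated (sym G wu″) u″t) | cover u′ z (separated wu′ wz)
      ...   | inj₂ wt | _ with same u′t wt u″q wq
      ...     | refl = exclusive u″q u″t
      finish | t , u′t , u″t | z , qz , wz | inj₁ wt | inj₁ u′z with same u′z wz u″q wq
      ...     | refl = irrefl G qz
      finish | t , u′t , u″t | z , qz , wz | inj₁ wt | inj₂ u′z =
        conflict (adj⇒≢ G wu′) (two-common wt u′t wu″ u′u″ (adj⇒≢ H u″t ∘ ≡-sym))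
          (Co.one-common wz u′z wq (sym H uu′) (sym G (far⇒adj-u wq)) (adj⇒≢ G qz ∘ ≡-sym) (coseparated wz wu))

  -- No neighbour of `w` is jointly dominable with `w`. Hence the neighbours of `w` are independent,
  -- each `tᵢ` has a private far neighbour `yᵢ`, and `w`, `y₁` end up jointly dominable in both
  -- graphs.
  no-three-neighbours : ∀ {w t₁ t₂ t₃} → E w t₁ → E w t₂ → E w t₃ → t₁ ≢ t₂ → t₁ ≢ t₃ → t₂ ≢ t₃ → ⊥
  no-three-neighbours {w} {t₁} {t₂} {t₃} wt₁ wt₂ wt₃ t₁≢t₂ t₁≢t₃ t₂≢t₃ = contradictory
    where
    third : ∀ a b → ∃[ t ] E w t × t ≢ a × t ≢ b
    third a b with t₁ ≟ a | t₁ ≟ b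
    ... | no  t₁≢a | no  t₁≢b = t₁ , wt₁ , t₁≢a , t₁≢b
    ... | yes refl | _ with t₂ ≟ b
    ...   | no  t₂≢b = t₂ , wt₂ , t₁≢t₂ ∘ ≡-sym , t₂≢b
    ...   | yes refl = t₃ , wt₃ , t₁≢t₃ ∘ ≡-sym , t₂≢t₃ ∘ ≡-sym
    third a b | no _ | yes refl with t₂ ≟ a
    ...   | no  t₂≢a = t₂ , wt₂ , t₂≢a , t₁≢t₂ ∘ ≡-sym
    ...   | yes refl = t₃ , wt₃ , t₂≢t₃ ∘ ≡-sym , t₁≢t₃ ∘ ≡-sym

    ¬joint : ∀ {u} → E w u → ¬ JointlyDominable G w u
    ¬joint wu joint = JointlyDominableNeighbour.impossible wu joint third

    -- If `u₁` and `u₂` were adjacent, `u₃` would see `z₁` and `z₂`, and the classes `u₂`, `z₁` and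
    -- `u₁`, `z₂` would jointly dominate `w` and `u₃`.
    neighbours-independent : ∀ {u v} → E w u → E w v → u ≢ v → N u v
    neighbours-independent {u₁} {u₂} wu₁ wu₂ u₁≢u₂ with cover u₁ u₂ u₁≢u₂
    ... | inj₂ e = e
    ... | inj₁ u₁u₂ with third u₁ u₂ | escape (adj⇒≢ G u₁u₂) | escape (adj⇒≢ G u₁u₂ ∘ ≡-sym)
    ...   | u₃ , wu₃ , u₃≢u₁ , u₃≢u₂ | z₁ , u₁z₁ , u₂z₁ | z₂ , u₂z₂ , u₁z₂ =
      ⊥-elim (¬joint wu₃ (none-common wu₂ (u₃-adj wu₁ wu₂ u₁u₂ u₃≢u₁ u₃≢u₂ u₁z₁ u₂z₁) u₂z₁
                                      wu₁ (u₃-adj wu₂ wu₁ (sym G u₁u₂) u₃≢u₂ u₃≢u₁ u₂z₂ u₁z₂) u₁z₂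
                                      (u₁≢u₂ ∘ ≡-sym) (adj⇒≢ G u₂z₂) (adj⇒≢ G u₁z₁ ∘ ≡-sym)
                                      (coseparated u₂z₁ u₂z₂)))
      where
      u₃-adj : ∀ {a b z} → E w a → E w b → E a b → u₃ ≢ a → u₃ ≢ b → E a z → N b z → E u₃ z
      u₃-adj {a} {b} {z} wa wb ab u₃≢a u₃≢b az bz with cover w z (separated (sym G wb) bz)
      ... | inj₁ wz = ⊥-elim (¬joint wa (two-common wb ab wz az (adj⇒≢ H bz)))
      ... | inj₂ wz with cover u₃ z (separated wu₃ wz)
      ...   | inj₁ e = e
      ...   | inj₂ e = ⊥-elim (¬joint wa (one-common wb ab wu₃ az e (u₃≢b ∘ ≡-sym) (adj⇒≢ H bz)))

    far : ∀ {a b y} → E w a → E w b → E a y → N b y → N w y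
    far {a} {b} {y} wa wb ay by with cover w y (separated (sym G wb) by)
    ... | inj₁ wy = ⊥-elim (exclusive ay (neighbours-independent wa wy (adj⇒≢ G ay)))
    ... | inj₂ wy = wy

    -- If the two escapes of `a` differ, pairing them with `b` and `c` makes `w` and `a` jointly
    -- dominable.
    private-neighbour : ∀ {a b c} → E w a → E w b → E w c → a ≢ b → a ≢ c → b ≢ c →
                        ∃[ y ] N w y × E a y × N b y × N c y
    private-neighbour {a} {b} {c} wa wb wc a≢b a≢c b≢c with escape a≢b | escape a≢c
    ... | y , ay , by | y′ , ay′ , cy′ with y ≟ y′
    ...   | yes refl = y , far wa wb ay by , ay , by , cy′
    ...   | no y≢y′ = ⊥-elim (¬joint wa (none-common wb ay by wc ay′ cy′ b≢c
                        (separated wb (far wa wc ay′ cy′)) (coseparated (far wa wb ay by) wc) y≢y′))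

    contradictory : ⊥
    contradictory with private-neighbour wt₁ wt₂ wt₃ t₁≢t₂ t₁≢t₃ t₂≢t₃
                     | private-neighbour wt₂ wt₁ wt₃ (t₁≢t₂ ∘ ≡-sym) t₂≢t₃ t₁≢t₃
                     | private-neighbour wt₃ wt₁ wt₂ (t₁≢t₃ ∘ ≡-sym) (t₂≢t₃ ∘ ≡-sym) t₁≢t₂
    ... | y₁ , wy₁ , t₁y₁ , t₂y₁ , t₃y₁ | y₂ , wy₂ , t₂y₂ , t₁y₂ , t₃y₂ | y₃ , wy₃ , t₃y₃ , t₁y₃ , t₂y₃ =
      conflict (adj⇒≢ H wy₁)
        (one-common wt₁ (sym G t₁y₁) wt₂ y₁y₃ t₂y₃ t₁≢t₂ (separated wt₁ wy₃))
        (Co.none-common wy₂ (sym H t₂y₁) (sym G t₂y₂) wy₃ (sym H t₃y₁) (sym G t₃y₃)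
          (separated t₂y₂ t₂y₃) (coseparated wy₂ wt₃) (separated wt₂ wy₃) t₂≢t₃)
      where
      privates-adjacent : ∀ {a b c x y z} → E w a → E w b → E w c → a ≢ b → a ≢ c → b ≢ c →
        E a x → N b x → E b y → N a z → N b z → N w x → N w y → N w z → E x y
      privates-adjacent {x = x} {y} wa wb wc a≢b a≢c b≢c ax bx by az bz wx wy wz
        with cover x y (coseparated bx by)
      ... | inj₁ e = e
      ... | inj₂ e = ⊥-elim (conflict a≢b
        (one-common (sym G wa) (sym G wb) ax by e (adj⇒≢ H wx) (adj⇒≢ H wy))
        (Co.two-common (neighbours-independent wa wc a≢c) (neighbours-independent wb wc b≢c)
          az bz (separated wc wz)))
      y₁y₃ : E y₁ y₃
      y₁y₃ = privates-adjacent wt₁ wt₃ wt₂ t₁≢t₃ t₁≢t₂ (t₂≢t₃ ∘ ≡-sym) t₁y₁ t₃y₁ t₃y₃ t₁y₂ t₃y₂ wy₁ wy₃ wy₂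

-- The 5-cycle

module _ {G H : SimpleGraph n} (compl : Complementary G H) (vertex : Fin 5 → Fin n)
         (index : Fin n → Fin 5) (vertex∘index : ∀ v → vertex (index v) ≡ v)
         (e₀₁ : Adj G (vertex 0F) (vertex 1F)) (e₁₂ : Adj G (vertex 1F) (vertex 2F))
         (e₂₃ : Adj G (vertex 2F) (vertex 3F)) (e₃₄ : Adj G (vertex 3F) (vertex 4F))
         (e₄₀ : Adj G (vertex 4F) (vertex 0F))
         (h₀₂ : Adj H (vertex 0F) (vertex 2F)) (h₁₃ : Adj H (vertex 1F) (vertex 3F))
         (h₂₄ : Adj H (vertex 2F) (vertex 4F)) (h₃₀ : Adj H (vertex 3F) (vertex 0F))
         (h₄₁ : Adj H (vertex 4F) (vertex 1F)) where

  open Complementary compl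

  private
    Table : Fin 5 → Fin 5 → Set
    Table i j = i ≡ j ⊎ (Adj C5 i j × Adj G (vertex i) (vertex j))
                      ⊎ (¬ Adj C5 i j × Adj H (vertex i) (vertex j))

    flip : ∀ {i j} → Table i j → Table j i
    flip         (inj₁ refl)            = inj₁ refl
    flip {i} {j} (inj₂ (inj₁ (ij , e))) = inj₂ (inj₁ (sym C5 {i} {j} ij , sym G e))
    flip {i} {j} (inj₂ (inj₂ (ij , h))) = inj₂ (inj₂ (ij ∘ sym C5 {j} {i} , sym H h))

    table : ∀ i j → Table i j
    table 0F 0F = inj₁ refl
    table 1F 1F = inj₁ refl
    table 2F 2F = inj₁ refl
    table 3F 3F = inj₁ refl
    table 4F 4F = inj₁ refl
    table 0F 1F = inj₂ (inj₁ (inj₁ refl , e₀₁))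
    table 1F 2F = inj₂ (inj₁ (inj₁ refl , e₁₂))
    table 2F 3F = inj₂ (inj₁ (inj₁ refl , e₂₃))
    table 3F 4F = inj₂ (inj₁ (inj₁ refl , e₃₄))
    table 4F 0F = inj₂ (inj₁ (inj₁ refl , e₄₀))
    table 0F 2F = inj₂ (inj₂ ((λ { (inj₁ ()) ; (inj₂ ()) }) , h₀₂))
    table 1F 3F = inj₂ (inj₂ ((λ { (inj₁ ()) ; (inj₂ ()) }) , h₁₃))
    table 2F 4F = inj₂ (inj₂ ((λ { (inj₁ ()) ; (inj₂ ()) }) , h₂₄))
    table 3F 0F = inj₂ (inj₂ ((λ { (inj₁ ()) ; (inj₂ ()) }) , h₃₀))
    table 4F 1F = inj₂ (inj₂ ((λ { (inj₁ ()) ; (inj₂ ()) }) , h₄₁))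
    table 1F 0F = flip (table 0F 1F)
    table 2F 1F = flip (table 1F 2F)
    table 3F 2F = flip (table 2F 3F)
    table 4F 3F = flip (table 3F 4F)
    table 0F 4F = flip (table 4F 0F)
    table 2F 0F = flip (table 0F 2F)
    table 3F 1F = flip (table 1F 3F)
    table 4F 2F = flip (table 2F 4F)
    table 0F 3F = flip (table 3F 0F)
    table 1F 4F = flip (table 4F 1F)

    -- Distinct labels are joined in `G` or in `H`, so they cannot name the same vertex.
    vertex-injective : ∀ i j → vertex i ≡ vertex j → i ≡ j
    vertex-injective i j e with table i j
    ... | inj₁ i≡j            = i≡j
    ... | inj₂ (inj₁ (_ , g)) = contradiction e (adj⇒≢ G g)
    ... | inj₂ (inj₂ (_ , h)) = contradiction e (adj⇒≢ H h)

    to-C5 : ∀ i j → Adj G (vertex i) (vertex j) → Adj C5 i j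
    to-C5 i j g with table i j
    ... | inj₁ refl            = contradiction g (irrefl G)
    ... | inj₂ (inj₁ (ij , _)) = ij
    ... | inj₂ (inj₂ (_ , h))  = contradiction h (exclusive g)

    from-C5 : ∀ i j → Adj C5 i j → Adj G (vertex i) (vertex j)
    from-C5 i j ij with table i j
    ... | inj₁ refl            = contradiction ij (irrefl C5 {i})
    ... | inj₂ (inj₁ (_ , g))  = g
    ... | inj₂ (inj₂ (¬ij , _)) = contradiction ij ¬ij

  five-cycle : Isomorphic G C5
  five-cycle = record
    { φ         = index
    ; bij       = (λ {u} {v} e → trans (≡-sym (vertex∘index u)) (trans (cong vertex e) (vertex∘index v)))
                , λ i → vertex i , λ { refl → vertex-injective _ i (vertex∘index (vertex i)) }
    ; preserves = λ u v g → to-C5 _ _ (subst₂ (Adj G) (≡-sym (vertex∘index u)) (≡-sym (vertex∘index v)) g)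
    ; reflects  = λ u v ij → subst₂ (Adj G) (vertex∘index u) (vertex∘index v) (from-C5 _ _ ij)
    }

-- The cycle is `w`, `u₁`, `z₁`, `z₂`, `u₂`, found by escaping. The degree bounds at `w` in `G` and
-- in `H` leave no further vertex.
irreducible⇒C5 : {G H : SimpleGraph n} → Complementary G H →
  (∀ {x y} → x ≢ y → ∃[ z ] Adj G x z × Adj H y z) →
  (∀ {w v} → w ≢ v → JointlyDominable G w v → ¬ JointlyDominable H w v) →
  ∀ {w y : Fin n} → w ≢ y → Isomorphic G C5
irreducible⇒C5 {n} {G} {H} compl escape conflict {w} w≢y with escape w≢y
... | u₁ , wu₁ , _ with escape (adj⇒≢ G wu₁)
...   | u₂ , wu₂ , u₁u₂ with escape (adj⇒≢ H u₁u₂) | escape (adj⇒≢ H u₁u₂ ∘ ≡-sym)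
...     | z₁ , u₁z₁ , u₂z₁ | z₂ , u₂z₂ , u₁z₂ =
  five-cycle compl vertex (proj₁ ∘ locate) (proj₂ ∘ locate)
    wu₁ u₁z₁ z₁z₂ (sym G u₂z₂) (sym G wu₂) wz₁ u₁z₂ (sym H u₂z₁) (sym H wz₂) (sym H u₁u₂)
  where
  open Complements compl
  open Irreducible compl escape conflict using (no-three-neighbours)

  -- Both hypotheses are self-dual, so the degree bound is available in `H` as well.
  coescape : ∀ {x y} → x ≢ y → ∃[ z ] Adj H x z × Adj G y z
  coescape x≢y with escape (x≢y ∘ ≡-sym)
  ... | z , yz , xz = z , xz , yz

  coconflict : ∀ {w v} → w ≢ v → JointlyDominable H w v → ¬ JointlyDominable G w v
  coconflict w≢v jH jG = conflict w≢v jG jH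

  open Irreducible (dual compl) coescape coconflict using () renaming (no-three-neighbours to no-three-coneighbours)

  vertex : Fin 5 → Fin n
  vertex 0F = w
  vertex 1F = u₁
  vertex 2F = z₁
  vertex 3F = z₂
  vertex 4F = u₂

  near : ∀ {v} → Adj G w v → v ≡ u₁ ⊎ v ≡ u₂
  near {v} wv with v ≟ u₁ | v ≟ u₂
  ... | yes e | _     = inj₁ e
  ... | no  _ | yes e = inj₂ e
  ... | no v≢u₁ | no v≢u₂ =
    ⊥-elim (no-three-neighbours wu₁ wu₂ wv (adj⇒≢ H u₁u₂) (v≢u₁ ∘ ≡-sym) (v≢u₂ ∘ ≡-sym))

  outside : ∀ {a b z} → Adj G w b → Adj G a z → Adj H b z →
            (∀ {v} → Adj G w v → v ≡ a ⊎ v ≡ b) → Adj H w z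
  outside {z = z} wb az bz near with cover w z (separated (sym G wb) bz)
  ... | inj₂ wz = wz
  ... | inj₁ wz with near wz
  ...   | inj₁ refl = ⊥-elim (irrefl G az)
  ...   | inj₂ refl = ⊥-elim (irrefl H bz)

  wz₁ : Adj H w z₁
  wz₁ = outside wu₂ u₁z₁ u₂z₁ near

  wz₂ : Adj H w z₂
  wz₂ = outside wu₁ u₂z₂ u₁z₂ (swap ∘ near)

  z₁≢z₂ : z₁ ≢ z₂
  z₁≢z₂ = separated u₁z₁ u₁z₂

  z₁z₂ : Adj G z₁ z₂
  z₁z₂ with cover z₁ z₂ z₁≢z₂
  ... | inj₁ e = e
  -- Otherwise `z₁` would have the three nonneighbours `w`, `u₂` and `z₂`.
  ... | inj₂ e = ⊥-elim (no-three-coneighbours (sym H wz₁) (sym H u₂z₁) e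
                   (adj⇒≢ G wu₂) (adj⇒≢ H wz₂) (adj⇒≢ G u₂z₂))

  locate : ∀ v → ∃[ i ] vertex i ≡ v
  locate v with v ≟ w
  ... | yes refl = 0F , refl
  ... | no  v≢w with cover w v (v≢w ∘ ≡-sym)
  ...   | inj₁ wv with near wv
  ...     | inj₁ refl = 1F , refl
  ...     | inj₂ refl = 4F , refl
  locate v | no _ | inj₂ wv with v ≟ z₁ | v ≟ z₂
  ...     | yes refl | _        = 2F , refl
  ...     | no  _    | yes refl = 3F , refl
  ...     | no v≢z₁  | no v≢z₂  =
    ⊥-elim (no-three-coneighbours wz₁ wz₂ wv z₁≢z₂ (v≢z₁ ∘ ≡-sym) (v≢z₂ ∘ ≡-sym))

-- Reduction to decidable adjacency

¬¬-∀ : {P : Fin n → Set} → (∀ i → ¬ ¬ P i) → ¬ ¬ (∀ i → P i)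
¬¬-∀ {zero}  ¬¬p ¬∀ = ¬∀ λ ()
¬¬-∀ {suc n} ¬¬p ¬∀ = ¬¬p zero λ p₀ → ¬¬-∀ (¬¬p ∘ suc) λ ps → ¬∀ (∀-cons p₀ ps)

complementary : (G : SimpleGraph n) → (∀ u v → Dec (Adj G u v)) → Complementary G (complement G)
complementary G adj? = record
  { cover     = cover
  ; exclusive = λ uv (_ , ¬uv) → ¬uv uv
  }
  where
  cover : ∀ u v → u ≢ v → Adj G u v ⊎ Adj (complement G) u v
  cover u v u≢v with adj? u v
  ... | yes uv = inj₁ uv
  ... | no ¬uv = inj₂ (u≢v , ¬uv)

theorem9 : ∀ (n : ℕ) → 2 ≤ n → (G : SimpleGraph n) → ¬ Isomorphic G C5 →
    ∀ (a b : ℕ) → IsRi2Number G a → IsRi2Number (complement G) b → a + b ≤ n + 2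
theorem9 (suc (suc n)) (s≤s (s≤s _)) G ¬C5 a b (_ , a-min) (_ , b-min) =
  decidable-stable (a + b ≤? _) λ a+b≰n+2 →
    -- Double negation commutes with the two finite quantifiers, so all adjacencies can be decided
    -- at once while deriving a contradiction.
    ¬¬-∀ (λ u → ¬¬-∀ λ v → ¬¬-excluded-middle) λ adj? →
      let compl = complementary G adj?
          ¬cheap : ¬ Cheap G (complement G)
          ¬cheap (f , g , rf , rg , w≤) = a+b≰n+2 (≤-trans (+-mono-≤ (a-min f rf) (b-min g rg)) w≤)
      in ¬C5 (irreducible⇒C5 compl (escape compl ¬cheap)
           (λ w≢v jG jH → ¬cheap (jointly-both⇒cheap compl w≢v jG jH)) {zero} {suc zero} λ ())
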